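{- For every integer $r\geq 2$, $$\sum_{M\geq1}g_r(M)z^M=\frac{z}{1-2z}\cdot\frac{(1-z)^{r-1}-z^{r-1}}{(1-z)^{r-1}-z^r}.$$
   Context: The perimeter of a nonempty partition $\lambda$ with largest part $\lambda_1$ and $\ell(\lambda)$ parts is $\lambda_1+\ell(\lambda)-1$. For $r\geq2$, $g_r(M)$ is the number of partitions with perimeter $M$ none of whose parts is divisible by $r$. -}

module Defs where

open import Data.Nat as ℕ using (ℕ; zero; suc; _∸_; _≤_; _<_; _≥_; s≤s)
import Data.Nat.Properties as ℕ
open import Data.Nat.Divisibility using (_∤_; _∣?_)
open import Data.Integer as ℤ using (ℤ; +_; 0ℤ; 1ℤ)
import Data.Integer.Properties as ℤ
open import Data.List as List using (List; []; _∷_; upTo; filter; cartesianProductWith)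
open import Data.List.NonEmpty as List⁺ using (List⁺; _∷_; toList)
open import Data.List.Membership.Propositional using (_∈_)
open import Data.List.Membership.Propositional.Properties using (∈-cartesianProductWith⁺; ∈-cartesianProductWith⁻; ∈-upTo⁺; ∈-filter⁺; ∈-filter⁻)
open import Data.List.Relation.Unary.All as All using (All; []; _∷_; all?)
open import Data.List.Relation.Unary.AllPairs using ([]; _∷_)
open import Data.List.Relation.Unary.Any using (here; there)
open import Data.List.Relation.Unary.Linked using (Linked; linked?)
open import Data.List.Relation.Unary.Linked.Properties using (Linked⇒All)
open import Data.List.Relation.Unary.Unique.Propositional using (Unique)
import Data.List.Relation.Unary.Unique.Propositional.Properties as Unique
open import Data.Product using (_×_; _,_; proj₂)
open import Function using (_∘_; _⇔_; mk⇔)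
open import Relation.Nullary using (Dec; ¬?; _×-dec_)
open import Relation.Binary.PropositionalEquality using (_≡_; _≢_; _≗_; refl; sym; trans; cong; cong₂; subst; module ≡-Reasoning)

IsPartition : List⁺ ℕ → Set
IsPartition p = All (0 <_) (toList p) × Linked _≥_ (toList p)

-- The parts are listed in weakly decreasing order, so the head is λ₁.
perimeter : List⁺ ℕ → ℕ
perimeter p = (List⁺.head p ℕ.+ List⁺.length p) ∸ 1

NoPartDivisibleBy : ℕ → List⁺ ℕ → Set
NoPartDivisibleBy r p = All (r ∤_) (toList p)

Counted : (r M : ℕ) → List⁺ ℕ → Set
Counted r M p = IsPartition p × perimeter p ≡ M × NoPartDivisibleBy r p

counted? : ∀ r M p → Dec (Counted r M p)
counted? r M p =
  (all? (0 ℕ.<?_) (toList p) ×-dec linked? ℕ._≥?_ (toList p))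
  ×-dec (perimeter p ℕ.≟ M)
  ×-dec all? (λ k → ¬? (r ∣? k)) (toList p)

-- All lists of length at most n with entries at most b, each exactly once.
boundedLists : (b n : ℕ) → List (List ℕ)
boundedLists b zero    = [] ∷ []
boundedLists b (suc n) =
  [] ∷ cartesianProductWith _∷_ (upTo (suc b)) (boundedLists b n)

-- A partition of perimeter M has parts at most M and at most M parts, so it
-- occurs here.
candidates : ℕ → List (List⁺ ℕ)
candidates M = cartesianProductWith _∷_ (upTo (suc M)) (boundedLists M M)

countedPartitions : (r M : ℕ) → List (List⁺ ℕ)
countedPartitions r M = filter (counted? r M) (candidates M)

-- By countedPartitions-unique and ∈-countedPartitions below, this is the
-- cardinality of the set of p with Counted r M p.
g : (r M : ℕ) → ℕ
g r M = List.length (countedPartitions r M)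

boundedLists-unique : ∀ b n → Unique (boundedLists b n)
boundedLists-unique b zero    = [] ∷ []
boundedLists-unique b (suc n) =
  All.tabulate (nonempty (upTo (suc b))) ∷
  Unique.cartesianProductWith⁺ _∷_ (λ { refl → refl , refl })
    (Unique.upTo⁺ (suc b)) (boundedLists-unique b n)
  where
  nonempty : ∀ xs {ys : List ℕ} → ys ∈ cartesianProductWith _∷_ xs (boundedLists b n) → [] ≢ ys
  nonempty xs m refl with ∈-cartesianProductWith⁻ List._∷_ xs (boundedLists b n) m
  ... | _ , _ , _ , _ , ()

countedPartitions-unique : ∀ r M → Unique (countedPartitions r M)
countedPartitions-unique r M = Unique.filter⁺ (counted? r M)
  (Unique.cartesianProductWith⁺ _∷_ (λ { refl → refl , refl })
    (Unique.upTo⁺ (suc M)) (boundedLists-unique M M))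

∈-boundedLists : ∀ {b} n {xs} → All (_≤ b) xs → List.length xs ≤ n → xs ∈ boundedLists b n
∈-boundedLists zero    []       _       = here refl
∈-boundedLists (suc n) []       _       = here refl
∈-boundedLists (suc n) (p ∷ ps) (s≤s l) =
  there (∈-cartesianProductWith⁺ _∷_ (∈-upTo⁺ (s≤s p)) (∈-boundedLists n ps l))

∈-countedPartitions : ∀ r M p → p ∈ countedPartitions r M ⇔ Counted r M p
∈-countedPartitions r M p = mk⇔
  (proj₂ ∘ ∈-filter⁻ (counted? r M) {xs = candidates M})
  (λ c → ∈-filter⁺ (counted? r M) (isCandidate p c) c)
  where
  isCandidate : ∀ q → Counted r M q → q ∈ candidates M
  isCandidate (x ∷ xs) ((_ , dec) , per , _) =
    ∈-cartesianProductWith⁺ _∷_ (∈-upTo⁺ (s≤s x≤M))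
      (∈-boundedLists M
        (All.tail (All.map (λ y≤x → ℕ.≤-trans y≤x x≤M)
          (Linked⇒All (λ p q → ℕ.≤-trans q p) ℕ.≤-refl dec)))
        (subst (List.length xs ≤_) x+l≡M (ℕ.m≤n+m _ x)))
    where
    x+l≡M : x ℕ.+ List.length xs ≡ M
    x+l≡M = trans (sym (cong (_∸ 1) (ℕ.+-suc x (List.length xs)))) per
    x≤M : x ≤ M
    x≤M = subst (x ≤_) x+l≡M (ℕ.m≤m+n x _)

Series : Set
Series = ℕ → ℤ

infix  4 _≈_
infixl 6 _⊖_
infixl 7 _⊗_ _•_
infixr 8 _^^_

_≈_ : Series → Series → Set
_≈_ = _≗_

𝟙 : Series
𝟙 zero    = 1ℤ
𝟙 (suc _) = 0ℤ

z : Series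
z 1 = 1ℤ
z _ = 0ℤ

_⊖_ : Series → Series → Series
(A ⊖ B) n = A n ℤ.- B n

_•_ : ℤ → Series → Series
(c • A) n = c ℤ.* A n

-- Σ≤ n f = f 0 + ⋯ + f n
Σ≤ : ℕ → (ℕ → ℤ) → ℤ
Σ≤ zero    f = f 0
Σ≤ (suc n) f = f 0 ℤ.+ Σ≤ n (f ∘ suc)

_⊗_ : Series → Series → Series
(A ⊗ B) n = Σ≤ n (λ i → A i ℤ.* B (n ∸ i))

_^^_ : Series → ℕ → Series
A ^^ zero  = 𝟙
A ^^ suc n = A ⊗ (A ^^ n)

-- The quotient A / B for B with constant term 1, by long division: with
-- a = A 0, A / B = a + z · (((A - a B) / z) / B).  See ÷-correct.
longDivision : Series → Series → Series
longDivision A B zero    = A 0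
longDivision A B (suc n) =
  longDivision (λ k → A (suc k) ℤ.- A 0 ℤ.* B (suc k)) B n

_÷_[_] : (A B : Series) → B 0 ≡ 1ℤ → Series
A ÷ B [ _ ] = longDivision A B

÷-correct : ∀ A B (B₀ : B 0 ≡ 1ℤ) → (A ÷ B [ B₀ ]) ⊗ B ≈ A
÷-correct A B B₀ zero    = trans (cong (A 0 ℤ.*_) B₀) (ℤ.*-identityʳ (A 0))
÷-correct A B B₀ (suc n) = begin
  a ℤ.+ ((A′ ÷ B [ B₀ ]) ⊗ B) n    ≡⟨ cong (λ t → a ℤ.+ t) (÷-correct A′ B B₀ n) ⟩
  a ℤ.+ (A (suc n) ℤ.- a)          ≡⟨ ℤ.+-comm a _ ⟩
  (A (suc n) ℤ.- a) ℤ.+ a          ≡⟨ ℤ.+-assoc (A (suc n)) (ℤ.- a) a ⟩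
  A (suc n) ℤ.+ (ℤ.- a ℤ.+ a)      ≡⟨ cong (λ t → A (suc n) ℤ.+ t) (ℤ.+-inverseˡ a) ⟩
  A (suc n) ℤ.+ 0ℤ                 ≡⟨ ℤ.+-identityʳ _ ⟩
  A (suc n)                        ∎
  where
  open ≡-Reasoning
  a : ℤ
  a = A 0 ℤ.* B (suc n)
  A′ : Series
  A′ k = A (suc k) ℤ.- A 0 ℤ.* B (suc k)

denominator₀ : ∀ r → 2 ≤ r → ((𝟙 ⊖ z) ^^ (r ∸ 1) ⊖ z ^^ r) 0 ≡ 1ℤ
denominator₀ (suc r) _ =
  cong₂ ℤ._-_ (pow₀ r) (ℤ.*-zeroˡ ((z ^^ r) 0))
  where
  pow₀ : ∀ k → ((𝟙 ⊖ z) ^^ k) 0 ≡ 1ℤ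
  pow₀ zero    = refl
  pow₀ (suc k) = trans (ℤ.*-identityˡ _) (pow₀ k)

-- Σ_{M≥1} f(M) z^M
Σ≥1 : (ℕ → ℕ) → Series
Σ≥1 f zero    = 0ℤ
Σ≥1 f (suc n) = + f (suc n)

{-# OPTIONS --safe #-}

-- Let W a be the generating function, by number of parts, of the partitions
-- with parts at most a, none divisible by r.  A counted partition is its
-- largest part a together with such a partition, so the series sought is
-- F = T 0, where T a = [r ∤ a] W a + z T (a + 1).  Write w = 1 - z.  Then
-- w W (a + 1) = W a if r ∤ a + 1, and W (a + 1) = W a otherwise, so
-- w ^ (r - 1) W (a + r) = W a and w ^ (r - 1) T r = T 0.  Unrolling the
-- recurrence from T 0 to T r and summing a geometric progression yields
-- (1 - 2z) w ^ (r - 1) (F - z ^ r T r) = z (w ^ (r - 1) - z ^ (r - 1)),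
-- where w ^ (r - 1) T r is again F.

module Submission where

open import Defs
open import Algebra.Bundles using (CommutativeRing)
import Algebra.Solver.Ring as RingSolver
open import Algebra.Solver.Ring.AlmostCommutativeRing using (_-Raw-AlmostCommutative⟶_; fromCommutativeRing)
open import Data.Bool using (if_then_else_)
open import Data.Integer as ℤ using (ℤ; +_; 0ℤ; 1ℤ)
import Data.Integer.Properties as ℤ
open import Data.Integer.Tactic.RingSolver using (solve-∀)
open import Data.List using (List; []; _∷_; _++_; map; length)
import Data.List.Properties as List
open import Data.List.Membership.Propositional using (_∈_)
open import Data.List.Membership.Propositional.Properties using (∈-map⁺; ∈-map⁻; ∈-++⁺ˡ; ∈-++⁺ʳ; ∈-++⁻)
open import Data.List.Membership.Propositional.Properties.WithK using (unique∧set⇒bag)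
open import Data.List.NonEmpty as List⁺ using (List⁺; _∷_; toList)
open import Data.List.Relation.Binary.BagAndSetEquality using (∼bag⇒↭)
open import Data.List.Relation.Binary.Permutation.Propositional.Properties using (↭-length)
open import Data.List.Relation.Unary.All as All using (All; []; _∷_)
open import Data.List.Relation.Unary.AllPairs using ([]; _∷_)
open import Data.List.Relation.Unary.Any using (here)
open import Data.List.Relation.Unary.Linked using (Linked; [-]; _∷_)
open import Data.List.Relation.Unary.Unique.Propositional using (Unique)
import Data.List.Relation.Unary.Unique.Propositional.Properties as Unique
open import Data.Maybe using (just; nothing)
open import Data.Nat as ℕ using (ℕ; zero; suc; _≤_; _<_; _≥_; _∸_; z≤n; s≤s)
import Data.Nat.Properties as ℕ
open import Data.Nat.Divisibility using (_∣_; _∤_; _∣?_; _∣0; ∣-refl; ∣m∣n⇒∣m+n; ∣m+n∣m⇒∣n; >⇒∤)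
open import Data.Product using (_×_; _,_)
open import Data.Sum using (inj₁; inj₂)
open import Function using (_∘_; _⇔_; mk⇔; Equivalence)
open import Level using (0ℓ)
open import Relation.Binary.Definitions using (WeaklyDecidable)
import Relation.Binary.Reasoning.Setoid as SetoidReasoning
open import Relation.Nullary using (Dec; yes; no; does; contradiction)
open import Relation.Binary.PropositionalEquality using (_≡_; refl; sym; trans; cong; cong₂; subst; module ≡-Reasoning)

-- The ring of formal power series

infixl 6 _⊕_

_⊕_ : Series → Series → Series
(A ⊕ B) n = A n ℤ.+ B n

⊝_ : Series → Series
(⊝ A) n = ℤ.- A n

𝟘 : Series
𝟘 _ = 0ℤ

-- By definition `(A ⊗ B) (suc n)` is `A 0 ℤ.* B (suc n) ℤ.+ ((A ∘ suc) ⊗ B) n`, so facts about `⊗`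
-- go by induction on the degree, with the left factor replaced by its tail.
⊗-cong : ∀ {A A′ B B′} → A ≈ A′ → B ≈ B′ → A ⊗ B ≈ A′ ⊗ B′
⊗-cong p q zero    = cong₂ ℤ._*_ (p 0) (q 0)
⊗-cong p q (suc n) =
  cong₂ ℤ._+_ (cong₂ ℤ._*_ (p 0) (q (suc n))) (⊗-cong (p ∘ suc) q n)

⊗-distribʳ-⊕ : ∀ C A B → (A ⊕ B) ⊗ C ≈ A ⊗ C ⊕ B ⊗ C
⊗-distribʳ-⊕ C A B zero    = ℤ.*-distribʳ-+ (C 0) (A 0) (B 0)
⊗-distribʳ-⊕ C A B (suc n) =
  trans (cong (λ t → (A 0 ℤ.+ B 0) ℤ.* C (suc n) ℤ.+ t) (⊗-distribʳ-⊕ C (A ∘ suc) (B ∘ suc) n))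
        (regroup (A 0) (B 0) (C (suc n)) _ _)
  where
  regroup : ∀ a b c s t →
    (a ℤ.+ b) ℤ.* c ℤ.+ (s ℤ.+ t) ≡ (a ℤ.* c ℤ.+ s) ℤ.+ (b ℤ.* c ℤ.+ t)
  regroup = solve-∀

•-⊗-assoc : ∀ c A B → (c • A) ⊗ B ≈ c • (A ⊗ B)
•-⊗-assoc c A B zero    = ℤ.*-assoc c (A 0) (B 0)
•-⊗-assoc c A B (suc n) =
  trans (cong₂ ℤ._+_ (ℤ.*-assoc c (A 0) (B (suc n))) (•-⊗-assoc c (A ∘ suc) B n))
        (sym (ℤ.*-distribˡ-+ c (A 0 ℤ.* B (suc n)) _))

⊗-assoc : ∀ A B C → (A ⊗ B) ⊗ C ≈ A ⊗ (B ⊗ C)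
⊗-assoc A B C zero    = ℤ.*-assoc (A 0) (B 0) (C 0)
⊗-assoc A B C (suc n) = begin
  -- The tail of `A ⊗ B` is `a • (B ∘ suc) ⊕ (A ∘ suc) ⊗ B` by definition.
  a ℤ.* b ℤ.* c ℤ.+ ((a • (B ∘ suc) ⊕ (A ∘ suc) ⊗ B) ⊗ C) n
    ≡⟨ cong (λ t → a ℤ.* b ℤ.* c ℤ.+ t) (⊗-distribʳ-⊕ C (a • (B ∘ suc)) ((A ∘ suc) ⊗ B) n) ⟩
  a ℤ.* b ℤ.* c ℤ.+ (((a • (B ∘ suc)) ⊗ C) n ℤ.+ (((A ∘ suc) ⊗ B) ⊗ C) n)
    ≡⟨ cong (λ t → a ℤ.* b ℤ.* c ℤ.+ t) (cong₂ ℤ._+_ (•-⊗-assoc a (B ∘ suc) C n) (⊗-assoc (A ∘ suc) B C n)) ⟩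
  a ℤ.* b ℤ.* c ℤ.+ (a ℤ.* ((B ∘ suc) ⊗ C) n ℤ.+ ((A ∘ suc) ⊗ (B ⊗ C)) n)
    ≡⟨ regroup a b c _ _ ⟩
  a ℤ.* (b ℤ.* c ℤ.+ ((B ∘ suc) ⊗ C) n) ℤ.+ ((A ∘ suc) ⊗ (B ⊗ C)) n ∎
  where
  open ≡-Reasoning
  a b c : ℤ
  a = A 0
  b = B 0
  c = C (suc n)
  regroup : ∀ a b c s t →
    a ℤ.* b ℤ.* c ℤ.+ (a ℤ.* s ℤ.+ t) ≡ a ℤ.* (b ℤ.* c ℤ.+ s) ℤ.+ t
  regroup = solve-∀

-- The definition peels the left factor; commutativity needs the same expansion from the right.
⊗-sucʳ : ∀ A B n → (A ⊗ B) (suc n) ≡ A (suc n) ℤ.* B 0 ℤ.+ (A ⊗ (B ∘ suc)) n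
⊗-sucʳ A B zero    = ℤ.+-comm (A 0 ℤ.* B 1) (A 1 ℤ.* B 0)
⊗-sucʳ A B (suc n) =
  trans (cong (λ t → A 0 ℤ.* B (suc (suc n)) ℤ.+ t) (⊗-sucʳ (A ∘ suc) B n))
        (swap (A 0 ℤ.* B (suc (suc n))) (A (suc (suc n)) ℤ.* B 0) _)
  where
  swap : ∀ x y t → x ℤ.+ (y ℤ.+ t) ≡ y ℤ.+ (x ℤ.+ t)
  swap = solve-∀

⊗-comm : ∀ A B → A ⊗ B ≈ B ⊗ A
⊗-comm A B zero    = ℤ.*-comm (A 0) (B 0)
⊗-comm A B (suc n) =
  trans (cong₂ ℤ._+_ (ℤ.*-comm (A 0) (B (suc n))) (⊗-comm (A ∘ suc) B n))
        (sym (⊗-sucʳ B A n))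

⊗-zeroˡ : ∀ A → 𝟘 ⊗ A ≈ 𝟘
⊗-zeroˡ A zero    = ℤ.*-zeroˡ (A 0)
⊗-zeroˡ A (suc n) = cong₂ ℤ._+_ (ℤ.*-zeroˡ (A (suc n))) (⊗-zeroˡ A n)

⊗-identityˡ : ∀ A → 𝟙 ⊗ A ≈ A
⊗-identityˡ A zero    = ℤ.*-identityˡ (A 0)
⊗-identityˡ A (suc n) =
  trans (cong₂ ℤ._+_ (ℤ.*-identityˡ (A (suc n))) (⊗-zeroˡ A n)) (ℤ.+-identityʳ _)

⊗-identityʳ : ∀ A → A ⊗ 𝟙 ≈ A
⊗-identityʳ A n = trans (⊗-comm A 𝟙 n) (⊗-identityˡ A n)

⊗-distribˡ-⊕ : ∀ C A B → C ⊗ (A ⊕ B) ≈ C ⊗ A ⊕ C ⊗ B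
⊗-distribˡ-⊕ C A B n =
  trans (⊗-comm C (A ⊕ B) n)
        (trans (⊗-distribʳ-⊕ C A B n) (cong₂ ℤ._+_ (⊗-comm A C n) (⊗-comm B C n)))

seriesRing : CommutativeRing 0ℓ 0ℓ
seriesRing = record
  { Carrier = Series
  ; _≈_     = _≈_
  ; _+_     = _⊕_
  ; _*_     = _⊗_
  ; -_      = ⊝_
  ; 0#      = 𝟘
  ; 1#      = 𝟙
  ; isCommutativeRing = record
    { isRing = record
      { +-isAbelianGroup = record
        { isGroup = record
          { isMonoid = record
            { isSemigroup = record
              { isMagma = record
                { isEquivalence = record
                  { refl  = λ _ → refl
                  ; sym   = λ p n → sym (p n)
                  ; trans = λ p q n → trans (p n) (q n)
                  }
                ; ∙-cong = λ p q n → cong₂ ℤ._+_ (p n) (q n)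
                }
              ; assoc = λ A B C n → ℤ.+-assoc (A n) (B n) (C n)
              }
            ; identity = (λ A n → ℤ.+-identityˡ (A n)) , (λ A n → ℤ.+-identityʳ (A n))
            }
          ; inverse = (λ A n → ℤ.+-inverseˡ (A n)) , (λ A n → ℤ.+-inverseʳ (A n))
          ; ⁻¹-cong = λ p n → cong ℤ.-_ (p n)
          }
        ; comm = λ A B n → ℤ.+-comm (A n) (B n)
        }
      ; *-cong     = ⊗-cong
      ; *-assoc    = ⊗-assoc
      ; *-identity = ⊗-identityˡ , ⊗-identityʳ
      ; distrib    = ⊗-distribˡ-⊕ , ⊗-distribʳ-⊕
      }
    ; *-comm = ⊗-comm
    }
  }

open CommutativeRing seriesRing using (setoid)
  renaming (refl to ≈-refl; sym to ≈-sym; trans to ≈-trans; +-cong to ⊕-cong)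

-- Equality of series is undecidable, so the solver takes its coefficients from `ℤ`, embedded as
-- constant series.
constants : ℤ.+-*-rawRing -Raw-AlmostCommutative⟶ fromCommutativeRing seriesRing
constants = record
  { ⟦_⟧    = _• 𝟙
  ; +-homo = λ c d n → ℤ.*-distribʳ-+ (𝟙 n) c d
  ; *-homo = λ c d n → trans (ℤ.*-assoc c d (𝟙 n))
      (sym (trans (•-⊗-assoc c 𝟙 (d • 𝟙) n) (cong (c ℤ.*_) (⊗-identityˡ (d • 𝟙) n))))
  ; -‿homo = λ c n → sym (ℤ.neg-distribˡ-* c (𝟙 n))
  ; 0-homo = λ n → ℤ.*-zeroˡ (𝟙 n)
  ; 1-homo = λ n → ℤ.*-identityˡ (𝟙 n)
  }

constants-≟ : WeaklyDecidable (λ c d → c • 𝟙 ≈ d • 𝟙)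
constants-≟ c d with c ℤ.≟ d
... | yes refl = just λ _ → refl
... | no _     = nothing

open RingSolver ℤ.+-*-rawRing (fromCommutativeRing seriesRing) constants constants-≟
  using (solve; _:=_; _:+_; _:*_; _:-_)

⊕-congˡ : ∀ A {B C} → B ≈ C → A ⊕ B ≈ A ⊕ C
⊕-congˡ A p n = cong (λ t → A n ℤ.+ t) (p n)

⊕-congʳ : ∀ A {B C} → B ≈ C → B ⊕ A ≈ C ⊕ A
⊕-congʳ A p n = cong (ℤ._+ A n) (p n)

⊖-congˡ : ∀ A {B C} → B ≈ C → A ⊖ B ≈ A ⊖ C
⊖-congˡ A p n = cong (λ t → A n ℤ.- t) (p n)

⊖-congʳ : ∀ A {B C} → B ≈ C → B ⊖ A ≈ C ⊖ A
⊖-congʳ A p n = cong (ℤ._- A n) (p n)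

⊗-congˡ : ∀ A {B C} → B ≈ C → A ⊗ B ≈ A ⊗ C
⊗-congˡ A p = ⊗-cong {A} {A} (λ _ → refl) p

⊗-congʳ : ∀ A {B C} → B ≈ C → B ⊗ A ≈ C ⊗ A
⊗-congʳ A p = ⊗-cong {B = A} {A} p (λ _ → refl)

-- 𝟙 ÷ A is an inverse of A.
⊗-cancelˡ : ∀ A {B C} → A 0 ≡ 1ℤ → A ⊗ B ≈ A ⊗ C → B ≈ C
⊗-cancelˡ A {B} {C} A₀ eq = begin
  B                ≈⟨ insert B ⟩
  A⁻¹ ⊗ (A ⊗ B)    ≈⟨ ⊗-congˡ A⁻¹ eq ⟩
  A⁻¹ ⊗ (A ⊗ C)    ≈⟨ insert C ⟨
  C                ∎
  where
  open SetoidReasoning setoid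
  A⁻¹ : Series
  A⁻¹ = 𝟙 ÷ A [ A₀ ]
  insert : ∀ X → X ≈ A⁻¹ ⊗ (A ⊗ X)
  insert X = begin
    X              ≈⟨ ⊗-identityˡ X ⟨
    𝟙 ⊗ X          ≈⟨ ⊗-congʳ X (÷-correct 𝟙 A A₀) ⟨
    (A⁻¹ ⊗ A) ⊗ X  ≈⟨ ⊗-assoc A⁻¹ A X ⟩
    A⁻¹ ⊗ (A ⊗ X)  ∎

-- Multiplication by `z` and recurrences

z-⊗-suc : ∀ A n → (z ⊗ A) (suc n) ≡ A n
z-⊗-suc A n = trans (cong₂ ℤ._+_ (ℤ.*-zeroˡ (A (suc n))) (lemma n)) (ℤ.+-identityˡ (A n))
  where
  z∘suc≈𝟙 : z ∘ suc ≈ 𝟙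
  z∘suc≈𝟙 zero    = refl
  z∘suc≈𝟙 (suc _) = refl
  lemma : (z ∘ suc) ⊗ A ≈ A
  lemma = ≈-trans (⊗-congʳ A z∘suc≈𝟙) (⊗-identityˡ A)

≈-⊕-z⊗ : ∀ {A B C} → A 0 ≡ B 0 → (∀ n → A (suc n) ≡ B (suc n) ℤ.+ C n) → A ≈ B ⊕ z ⊗ C
≈-⊕-z⊗ {A} {B} {C} A₀ _  zero    =
  trans A₀ (sym (trans (cong (λ t → B 0 ℤ.+ t) (ℤ.*-zeroˡ (C 0))) (ℤ.+-identityʳ (B 0))))
≈-⊕-z⊗ {A} {B} {C} _ A₊ (suc n) =
  trans (A₊ n) (cong (λ t → B (suc n) ℤ.+ t) (sym (z-⊗-suc C n)))

-- The index `a` only grows and there is no base case in it. The factor `z` makes coefficient `n` at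
-- `a` depend only on coefficient `n - 1` at `suc a`, so induction on `n`, for all `a` at once,
-- settles it.
z-recurrence-unique : ∀ {P X Y : ℕ → Series} →
  (∀ a → X a ≈ P a ⊕ z ⊗ X (suc a)) → (∀ a → Y a ≈ P a ⊕ z ⊗ Y (suc a)) →
  ∀ a → X a ≈ Y a
z-recurrence-unique {P} {X} {Y} recX recY = go
  where
  tails : ∀ a n → (z ⊗ X (suc a)) n ≡ (z ⊗ Y (suc a)) n
  go    : ∀ a n → X a n ≡ Y a n
  tails a zero    = trans (ℤ.*-zeroˡ (X (suc a) 0)) (sym (ℤ.*-zeroˡ (Y (suc a) 0)))
  tails a (suc n) =
    trans (z-⊗-suc (X (suc a)) n) (trans (go (suc a) n) (sym (z-⊗-suc (Y (suc a)) n)))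
  go a n = trans (recX a n) (trans (cong (λ t → P a n ℤ.+ t) (tails a n)) (sym (recY a n)))

w h : Series
w = 𝟙 ⊖ z
h = 𝟙 ⊖ (+ 2) • z

w-⊗ : ∀ A → w ⊗ A ≈ A ⊖ z ⊗ A
w-⊗ A = ≈-trans (solve 3 (λ o z A → (o :- z) :* A := o :* A :- z :* A) ≈-refl 𝟙 z A)
                (⊖-congʳ (z ⊗ A) (⊗-identityˡ A))

h≈w⊖z : h ≈ w ⊖ z
h≈w⊖z n = split (𝟙 n) (z n)
  where
  split : ∀ o x → o ℤ.- (+ 2) ℤ.* x ≡ (o ℤ.- x) ℤ.- x
  split = solve-∀

-- Enumerating the counted partitions by largest part

module Enumeration (r : ℕ) where

  -- boundedBy a n: the partitions into n parts at most a, none divisible by r.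
  -- leading a n: those with largest part a and n further parts.
  boundedBy : ℕ → ℕ → List (List ℕ)
  leading   : ℕ → ℕ → List (List⁺ ℕ)
  boundedBy a       zero    = [] ∷ []
  boundedBy zero    (suc n) = []
  boundedBy (suc a) (suc n) = map toList (leading (suc a) n) ++ boundedBy a (suc n)
  leading a n = if does (r ∣? a) then [] else map (a ∷_) (boundedBy a n)

  -- The partitions with largest part at least a and perimeter a + n.
  startingAt : ℕ → ℕ → List (List⁺ ℕ)
  startingAt a zero    = leading a zero
  startingAt a (suc n) = leading a (suc n) ++ startingAt (suc a) n

  -- `Linked` on `a ∷ xs` expresses both the bound `a` and the weak decrease. Positivity of the
  -- parts follows from `indivisible`, since `r` divides 0.
  record Bounded (a n : ℕ) (xs : List ℕ) : Set where
    constructor bounded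
    field
      length≡     : length xs ≡ n
      indivisible : All (r ∤_) xs
      decreasing  : Linked _≥_ (a ∷ xs)

  leading-∣ : ∀ a n → r ∣ a → leading a n ≡ []
  leading-∣ a n r∣a with r ∣? a
  ... | yes _   = refl
  ... | no  r∤a = contradiction r∣a r∤a

  leading-∤ : ∀ a n → r ∤ a → leading a n ≡ map (a ∷_) (boundedBy a n)
  leading-∤ a n r∤a with r ∣? a
  ... | yes r∣a = contradiction r∣a r∤a
  ... | no  _   = refl

  ∈-leading⁺ : ∀ a n {xs} → r ∤ a → xs ∈ boundedBy a n → (a ∷ xs) ∈ leading a n
  ∈-leading⁺ a n {xs} r∤a xs∈ =
    subst ((a ∷ xs) ∈_) (sym (leading-∤ a n r∤a)) (∈-map⁺ (a ∷_) xs∈)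

  ∈-leading⁻ : ∀ a n {x xs} → (x ∷ xs) ∈ leading a n → x ≡ a × r ∤ a × xs ∈ boundedBy a n
  ∈-leading⁻ a n p∈ with r ∣? a
  ∈-leading⁻ a n () | yes _
  ∈-leading⁻ a n p∈ | no r∤a with ∈-map⁻ (a ∷_) p∈
  ... | _ , xs∈ , refl = refl , r∤a , xs∈

  ∈-boundedBy⁻ : ∀ a n {xs} → xs ∈ boundedBy a n → Bounded a n xs
  ∈-boundedBy⁻ a       zero    (here refl) = bounded refl [] [-]
  ∈-boundedBy⁻ (suc a) (suc n) xs∈ with ∈-++⁻ (map toList (leading (suc a) n)) xs∈
  ... | inj₁ ∈l with ∈-map⁻ toList ∈l
  ...   | y ∷ ys , p∈ , refl with ∈-leading⁻ (suc a) n p∈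
  ...     | refl , r∤ , ys∈ with ∈-boundedBy⁻ (suc a) n ys∈
  ...       | bounded l i d = bounded (cong suc l) (r∤ ∷ i) (ℕ.≤-refl ∷ d)
  ∈-boundedBy⁻ (suc a) (suc n) xs∈ | inj₂ ∈r with ∈-boundedBy⁻ a (suc n) ∈r
  ... | bounded l i (y≤a ∷ d) = bounded l i (ℕ.m≤n⇒m≤1+n y≤a ∷ d)

  ∈-boundedBy⁺ : ∀ a n {xs} → Bounded a n xs → xs ∈ boundedBy a n
  ∈-boundedBy⁺ a       zero    {[]}     _ = here refl
  -- A part bounded by 0 is 0, which `r` divides.
  ∈-boundedBy⁺ zero    (suc n) {y ∷ ys} (bounded _ (r∤y ∷ _) (z≤n ∷ _)) =
    contradiction (r ∣0) r∤y
  ∈-boundedBy⁺ (suc a) (suc n) {y ∷ ys} (bounded l (r∤y ∷ i) (y≤ ∷ d)) with ℕ.m≤n⇒m<n∨m≡n y≤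
  ... | inj₁ (s≤s y≤a) =
    ∈-++⁺ʳ (map toList (leading (suc a) n)) (∈-boundedBy⁺ a (suc n) (bounded l (r∤y ∷ i) (y≤a ∷ d)))
  ... | inj₂ refl =
    ∈-++⁺ˡ (∈-map⁺ toList (∈-leading⁺ (suc a) n r∤y (∈-boundedBy⁺ (suc a) n (bounded (ℕ.suc-injective l) i d))))

  toList-injective : ∀ {p q : List⁺ ℕ} → toList p ≡ toList q → p ≡ q
  toList-injective {_ ∷ _} {_ ∷ _} refl = refl

  leading-unique   : ∀ a n → Unique (leading a n)
  boundedBy-unique : ∀ a n → Unique (boundedBy a n)
  leading-unique a n with r ∣? a
  ... | yes _ = []
  ... | no  _ = Unique.map⁺ (λ { refl → refl }) (boundedBy-unique a n)
  boundedBy-unique a       zero    = [] ∷ []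
  boundedBy-unique zero    (suc n) = []
  boundedBy-unique (suc a) (suc n) =
    Unique.++⁺ (Unique.map⁺ toList-injective (leading-unique (suc a) n))
               (boundedBy-unique a (suc n)) λ (∈l , ∈r) → disjoint ∈l ∈r
    where
    -- A common member would have first part `suc a` and yet be bounded by `a`.
    disjoint : ∀ {xs} → xs ∈ map toList (leading (suc a) n) → xs ∈ boundedBy a (suc n) → _
    disjoint ∈l ∈r with ∈-map⁻ toList ∈l
    ... | _ ∷ _ , p∈ , refl with ∈-leading⁻ (suc a) n p∈ | ∈-boundedBy⁻ a (suc n) ∈r
    ...   | refl , _ | bounded _ _ (1+a≤a ∷ _) = ℕ.1+n≰n 1+a≤a

  -- The perimeter appears without truncated subtraction, and `n` is its excess over `a`: raising
  -- `a` by one lowers `n` by one.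
  record StartsAt (a n : ℕ) (p : List⁺ ℕ) : Set where
    constructor startsAt
    field
      a≤head      : a ≤ List⁺.head p
      perimeter≡  : List⁺.head p ℕ.+ length (List⁺.tail p) ≡ a ℕ.+ n
      indivisible : NoPartDivisibleBy r p
      decreasing  : Linked _≥_ (toList p)

  leading⇒StartsAt : ∀ a n {p} → p ∈ leading a n → StartsAt a n p
  leading⇒StartsAt a n {x ∷ xs} p∈ with ∈-leading⁻ a n p∈
  ... | refl , r∤ , xs∈ with ∈-boundedBy⁻ a n xs∈
  ...   | bounded l i d = startsAt ℕ.≤-refl (cong (a ℕ.+_) l) (r∤ ∷ i) d

  StartsAt⇒leading : ∀ a n {xs} → StartsAt a n (a ∷ xs) → (a ∷ xs) ∈ leading a n
  StartsAt⇒leading a n (startsAt _ e (r∤ ∷ i) d) =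
    ∈-leading⁺ a n r∤ (∈-boundedBy⁺ a n (bounded (ℕ.+-cancelˡ-≡ a _ _ e) i d))

  ∈-startingAt⁻ : ∀ a n {p} → p ∈ startingAt a n → StartsAt a n p
  ∈-startingAt⁻ a zero    p∈ = leading⇒StartsAt a zero p∈
  ∈-startingAt⁻ a (suc n) p∈ with ∈-++⁻ (leading a (suc n)) p∈
  ... | inj₁ ∈l = leading⇒StartsAt a (suc n) ∈l
  ... | inj₂ ∈r with ∈-startingAt⁻ (suc a) n ∈r
  ...   | startsAt a< e i d = startsAt (ℕ.<⇒≤ a<) (trans e (sym (ℕ.+-suc a n))) i d

  ∈-startingAt⁺ : ∀ a n {p} → StartsAt a n p → p ∈ startingAt a n
  ∈-startingAt⁺ a n {x ∷ xs} s@(startsAt a≤x e i d) with ℕ.m≤n⇒m<n∨m≡n a≤x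
  ∈-startingAt⁺ a zero    s | inj₂ refl = StartsAt⇒leading a zero s
  ∈-startingAt⁺ a (suc n) s | inj₂ refl = ∈-++⁺ˡ (StartsAt⇒leading a (suc n) s)
  -- The head exceeds `a`, yet it is at most the perimeter, which is `a + 0`.
  ∈-startingAt⁺ a zero {x ∷ xs} (startsAt _ e _ _) | inj₁ a<x = contradiction
    (ℕ.≤-trans (ℕ.m≤m+n x (length xs)) (ℕ.≤-reflexive (trans e (ℕ.+-identityʳ a)))) (ℕ.<⇒≱ a<x)
  ∈-startingAt⁺ a (suc n) (startsAt _ e i d) | inj₁ a<x =
    ∈-++⁺ʳ (leading a (suc n)) (∈-startingAt⁺ (suc a) n (startsAt a<x (trans e (ℕ.+-suc a n)) i d))

  startingAt-unique : ∀ a n → Unique (startingAt a n)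
  startingAt-unique a zero    = leading-unique a zero
  startingAt-unique a (suc n) =
    Unique.++⁺ (leading-unique a (suc n)) (startingAt-unique (suc a) n) λ (∈l , ∈r) → disjoint ∈l ∈r
    where
    disjoint : ∀ {p} → p ∈ leading a (suc n) → p ∈ startingAt (suc a) n → _
    disjoint {_ ∷ _} ∈l ∈r with ∈-leading⁻ a (suc n) ∈l | ∈-startingAt⁻ (suc a) n ∈r
    ... | refl , _ | startsAt a<a _ _ _ = ℕ.1+n≰n a<a

  perimeter-∷ : ∀ x (xs : List ℕ) → perimeter (x ∷ xs) ≡ x ℕ.+ length xs
  perimeter-∷ x xs = cong (_∸ 1) (ℕ.+-suc x (length xs))

  ∤⇒positive : ∀ {x} → r ∤ x → 0 < x
  ∤⇒positive {zero}  r∤0 = contradiction (r ∣0) r∤0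
  ∤⇒positive {suc x} _   = s≤s z≤n

  -- At `a = 0` the lower bound on the head is vacuous, and positivity comes from indivisibility.
  StartsAt⇔Counted : ∀ M p → StartsAt 0 M p ⇔ Counted r M p
  StartsAt⇔Counted M (x ∷ xs) = mk⇔
    (λ (startsAt _ e i d) → (All.map ∤⇒positive i , d) , trans (perimeter-∷ x xs) e , i)
    (λ ((_ , d) , e , i) → startsAt z≤n (trans (sym (perimeter-∷ x xs)) e) i d)

  -- Two duplicate-free lists with the same members are permutations of each other.
  length-startingAt : ∀ M → length (startingAt 0 M) ≡ g r M
  length-startingAt M = ↭-length (∼bag⇒↭ (unique∧set⇒bag
    (startingAt-unique 0 M) (countedPartitions-unique r M) (λ {p} → sameMembers p)))
    where
    sameMembers : ∀ p → p ∈ startingAt 0 M ⇔ p ∈ countedPartitions r M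
    sameMembers p = mk⇔
      (from (∈-countedPartitions r M p) ∘ to (StartsAt⇔Counted M p) ∘ ∈-startingAt⁻ 0 M)
      (∈-startingAt⁺ 0 M ∘ from (StartsAt⇔Counted M p) ∘ to (∈-countedPartitions r M p))
      where open Equivalence

-- The generating functions; r = suc m

module GeneratingFunctions (m : ℕ) where

  r : ℕ
  r = suc m

  open Enumeration r

  -- The exponent of `z` marks the number of parts in `W a`, the number of parts after the first in
  -- `L a`, and the perimeter minus `a` in `T a`; thus in `T 0` it is the perimeter.
  W L T : ℕ → Series
  W a n = + length (boundedBy a n)
  L a n = + length (leading a n)
  T a n = + length (startingAt a n)

  W-zero : W 0 ≈ 𝟙
  W-zero zero    = refl
  W-zero (suc _) = refl

  -- Either the first part is `suc a` or all parts are at most `a`. The factor `z` counts that first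
  -- part, which `L` leaves out.
  W-suc : ∀ a → W (suc a) ≈ W a ⊕ z ⊗ L (suc a)
  W-suc a = ≈-⊕-z⊗ {W (suc a)} {W a} {L (suc a)} refl λ n → cong +_ (begin
    length (map toList (leading (suc a) n) ++ boundedBy a (suc n))
      ≡⟨ List.length-++ (map toList (leading (suc a) n)) ⟩
    length (map toList (leading (suc a) n)) ℕ.+ length (boundedBy a (suc n))
      ≡⟨ cong (ℕ._+ length (boundedBy a (suc n))) (List.length-map toList (leading (suc a) n)) ⟩
    length (leading (suc a) n) ℕ.+ length (boundedBy a (suc n))
      ≡⟨ ℕ.+-comm (length (leading (suc a) n)) (length (boundedBy a (suc n))) ⟩
    length (boundedBy a (suc n)) ℕ.+ length (leading (suc a) n) ∎)
    where open ≡-Reasoning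

  L-∣ : ∀ {a} → r ∣ a → L a ≈ 𝟘
  L-∣ {a} r∣a n = cong (λ ps → + length ps) (leading-∣ a n r∣a)

  L-∤ : ∀ {a} → r ∤ a → L a ≈ W a
  L-∤ {a} r∤a n = cong +_ (trans (cong length (leading-∤ a n r∤a)) (List.length-map (a ∷_) (boundedBy a n)))

  -- The largest part is `a` or at least `suc a`; the factor `z` accounts for measuring the
  -- perimeter from `suc a` instead of `a`.
  T-unroll : ∀ a → T a ≈ L a ⊕ z ⊗ T (suc a)
  T-unroll a = ≈-⊕-z⊗ {T a} {L a} {T (suc a)} refl λ n →
    cong +_ (List.length-++ (leading a (suc n)))

  W-suc-∣ : ∀ a → r ∣ suc a → W (suc a) ≈ W a
  W-suc-∣ a r∣ = begin
    W (suc a)               ≈⟨ W-suc a ⟩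
    W a ⊕ z ⊗ L (suc a)     ≈⟨ ⊕-congˡ (W a) (⊗-congˡ z (L-∣ r∣)) ⟩
    W a ⊕ z ⊗ 𝟘             ≈⟨ ⊕-congˡ (W a) (⊗-comm z 𝟘) ⟩
    W a ⊕ 𝟘 ⊗ z             ≈⟨ ⊕-congˡ (W a) (⊗-zeroˡ z) ⟩
    W a ⊕ 𝟘                 ≈⟨ (λ n → ℤ.+-identityʳ (W a n)) ⟩
    W a                     ∎
    where open SetoidReasoning setoid

  -- Removing one part `suc a` leaves an arbitrary partition counted by `W (suc a)`, so `W-suc`
  -- becomes `W (suc a) ≈ W a ⊕ z ⊗ W (suc a)`.
  w-W-suc : ∀ a → r ∤ suc a → w ⊗ W (suc a) ≈ W a
  w-W-suc a r∤ = begin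
    w ⊗ W (suc a)                             ≈⟨ w-⊗ (W (suc a)) ⟩
    W (suc a) ⊖ z ⊗ W (suc a)                 ≈⟨ ⊖-congʳ (z ⊗ W (suc a)) (W-suc a) ⟩
    (W a ⊕ z ⊗ L (suc a)) ⊖ z ⊗ W (suc a)     ≈⟨ ⊖-congʳ (z ⊗ W (suc a)) (⊕-congˡ (W a) (⊗-congˡ z (L-∤ r∤))) ⟩
    (W a ⊕ z ⊗ W (suc a)) ⊖ z ⊗ W (suc a)     ≈⟨ solve 2 (λ A B → (A :+ B) :- B := A) ≈-refl (W a) (z ⊗ W (suc a)) ⟩
    W a                                       ∎
    where open SetoidReasoning setoid

  -- None of the part sizes from 1 to `k` is divisible by `r`, so each contributes one factor `w`.
  w^k-W : ∀ k → k < r → w ^^ k ⊗ W k ≈ 𝟙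
  w^k-W zero    _   = ≈-trans (⊗-identityˡ (W 0)) W-zero
  w^k-W (suc k) k<r = begin
    (w ⊗ w ^^ k) ⊗ W (suc k)    ≈⟨ solve 3 (λ w v X → (w :* v) :* X := v :* (w :* X)) ≈-refl w (w ^^ k) (W (suc k)) ⟩
    w ^^ k ⊗ (w ⊗ W (suc k))    ≈⟨ ⊗-congˡ (w ^^ k) (w-W-suc k (>⇒∤ k<r)) ⟩
    w ^^ k ⊗ W k                ≈⟨ w^k-W k (ℕ.<⇒≤ k<r) ⟩
    𝟙                           ∎
    where open SetoidReasoning setoid

  -- Shifting the bound by `r`

  ∣⇒∣+r : ∀ {a} → r ∣ a → r ∣ a ℕ.+ r
  ∣⇒∣+r r∣a = ∣m∣n⇒∣m+n r∣a ∣-refl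

  ∤⇒∤+r : ∀ {a} → r ∤ a → r ∤ a ℕ.+ r
  ∤⇒∤+r {a} r∤a r∣a+r = r∤a (∣m+n∣m⇒∣n (subst (r ∣_) (ℕ.+-comm a r) r∣a+r) ∣-refl)

  -- Among `r` consecutive integers exactly `m` are not divisible by `r`. In the induction `suc a`
  -- and `suc a ℕ.+ r` are divisible by `r` together, so both sides change by the same factor.
  W-period : ∀ a → w ^^ m ⊗ W (a ℕ.+ r) ≈ W a
  W-period zero = begin
    w ^^ m ⊗ W (suc m)   ≈⟨ ⊗-congˡ (w ^^ m) (W-suc-∣ m ∣-refl) ⟩
    w ^^ m ⊗ W m         ≈⟨ w^k-W m ℕ.≤-refl ⟩
    𝟙                    ≈⟨ W-zero ⟨
    W 0                  ∎
    where open SetoidReasoning setoid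
  W-period (suc a) with r ∣? suc a
  ... | yes r∣ = begin
    w ^^ m ⊗ W (suc (a ℕ.+ r))    ≈⟨ ⊗-congˡ (w ^^ m) (W-suc-∣ (a ℕ.+ r) (∣⇒∣+r r∣)) ⟩
    w ^^ m ⊗ W (a ℕ.+ r)          ≈⟨ W-period a ⟩
    W a                           ≈⟨ W-suc-∣ a r∣ ⟨
    W (suc a)                     ∎
    where open SetoidReasoning setoid
  ... | no r∤ = ⊗-cancelˡ w refl (begin
    w ⊗ (w ^^ m ⊗ W (suc (a ℕ.+ r)))    ≈⟨ solve 3 (λ w v X → w :* (v :* X) := v :* (w :* X)) ≈-refl w (w ^^ m) (W (suc (a ℕ.+ r))) ⟩
    w ^^ m ⊗ (w ⊗ W (suc (a ℕ.+ r)))    ≈⟨ ⊗-congˡ (w ^^ m) (w-W-suc (a ℕ.+ r) (∤⇒∤+r r∤)) ⟩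
    w ^^ m ⊗ W (a ℕ.+ r)                ≈⟨ W-period a ⟩
    W a                                 ≈⟨ w-W-suc a r∤ ⟨
    w ⊗ W (suc a)                       ∎)
    where open SetoidReasoning setoid

  L-period : ∀ a → w ^^ m ⊗ L (a ℕ.+ r) ≈ L a
  L-period a = helper (r ∣? a)
    where
    open SetoidReasoning setoid
    helper : Dec (r ∣ a) → w ^^ m ⊗ L (a ℕ.+ r) ≈ L a
    helper (yes r∣a) = begin
      w ^^ m ⊗ L (a ℕ.+ r)   ≈⟨ ⊗-congˡ (w ^^ m) (L-∣ (∣⇒∣+r r∣a)) ⟩
      w ^^ m ⊗ 𝟘             ≈⟨ ⊗-comm (w ^^ m) 𝟘 ⟩
      𝟘 ⊗ w ^^ m             ≈⟨ ⊗-zeroˡ (w ^^ m) ⟩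
      𝟘                      ≈⟨ L-∣ r∣a ⟨
      L a                    ∎
    helper (no r∤a) = begin
      w ^^ m ⊗ L (a ℕ.+ r)   ≈⟨ ⊗-congˡ (w ^^ m) (L-∤ (∤⇒∤+r r∤a)) ⟩
      w ^^ m ⊗ W (a ℕ.+ r)   ≈⟨ W-period a ⟩
      W a                    ≈⟨ L-∤ r∤a ⟨
      L a                    ∎

  -- By `L-period` both sides satisfy the recurrence `T-unroll`, whose solution is unique.
  T-period : ∀ a → w ^^ m ⊗ T (a ℕ.+ r) ≈ T a
  T-period = z-recurrence-unique {P = L} step T-unroll
    where
    open SetoidReasoning setoid
    step : ∀ a → w ^^ m ⊗ T (a ℕ.+ r) ≈ L a ⊕ z ⊗ (w ^^ m ⊗ T (suc a ℕ.+ r))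
    step a = begin
      w ^^ m ⊗ T (a ℕ.+ r)
        ≈⟨ ⊗-congˡ (w ^^ m) (T-unroll (a ℕ.+ r)) ⟩
      w ^^ m ⊗ (L (a ℕ.+ r) ⊕ z ⊗ T (suc a ℕ.+ r))
        ≈⟨ solve 4 (λ v X z Y → v :* (X :+ z :* Y) := v :* X :+ z :* (v :* Y)) ≈-refl
             (w ^^ m) (L (a ℕ.+ r)) z (T (suc a ℕ.+ r)) ⟩
      w ^^ m ⊗ L (a ℕ.+ r) ⊕ z ⊗ (w ^^ m ⊗ T (suc a ℕ.+ r))
        ≈⟨ ⊕-congʳ (z ⊗ (w ^^ m ⊗ T (suc a ℕ.+ r))) (L-period a) ⟩
      L a ⊕ z ⊗ (w ^^ m ⊗ T (suc a ℕ.+ r)) ∎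

  -- The left side is h = 1 - 2z times the sum of z ^ j w ^ (k - j) over
  -- 1 ≤ j ≤ k, a geometric progression.
  partial-sum : ∀ k → k < r →
    h ⊗ (w ^^ k ⊗ (T 0 ⊖ z ^^ suc k ⊗ T (suc k))) ≈ z ⊗ (w ^^ k ⊖ z ^^ k)
  partial-sum zero _ = begin
    h ⊗ (𝟙 ⊗ (T 0 ⊖ (z ⊗ 𝟙) ⊗ T 1))
      -- Since `r` divides 0, `L 0` vanishes and `T 0` equals `z ⊗ T 1`: the sum is empty.
      ≈⟨ ⊗-congˡ h (⊗-congˡ 𝟙 (≈-trans
           (⊖-congʳ ((z ⊗ 𝟙) ⊗ T 1) (≈-trans (T-unroll 0) (⊕-congʳ (z ⊗ T 1) (L-∣ (r ∣0)))))
           (⊖-congˡ (𝟘 ⊕ z ⊗ T 1) (⊗-congʳ (T 1) (⊗-identityʳ z))))) ⟩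
    h ⊗ (𝟙 ⊗ ((𝟘 ⊕ z ⊗ T 1) ⊖ z ⊗ T 1))
      ≈⟨ solve 4 (λ h o e X → h :* (o :* ((e :+ X) :- X)) := e :* (h :* o)) ≈-refl h 𝟙 𝟘 (z ⊗ T 1) ⟩
    𝟘 ⊗ (h ⊗ 𝟙)
      ≈⟨ ≈-trans (⊗-zeroˡ (h ⊗ 𝟙)) (≈-sym (⊗-zeroˡ z)) ⟩
    𝟘 ⊗ z
      ≈⟨ ⊗-comm 𝟘 z ⟩
    z ⊗ 𝟘
      ≈⟨ ⊗-congˡ z (λ n → sym (ℤ.+-inverseʳ (𝟙 n))) ⟩
    z ⊗ (𝟙 ⊖ 𝟙) ∎
    where open SetoidReasoning setoid
  partial-sum (suc k) k<r = begin
    h ⊗ ((w ⊗ v) ⊗ (T 0 ⊖ (z ⊗ (z ⊗ y)) ⊗ T₂))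
      -- The term in `X`, which stands for `W (suc k)`, is subtracted and added back, so that
      -- `X :+ z :* T₂` becomes `T (suc k)` and the induction hypothesis applies.
      ≈⟨ solve 8 (λ h w v F z y T₂ X →
           h :* ((w :* v) :* (F :- (z :* (z :* y)) :* T₂))
             := w :* (h :* (v :* (F :- (z :* y) :* (X :+ z :* T₂)))) :+ (h :* (z :* y)) :* ((w :* v) :* X))
           ≈-refl h w v (T 0) z y T₂ (W (suc k)) ⟩
    w ⊗ (h ⊗ (v ⊗ (T 0 ⊖ (z ⊗ y) ⊗ (W (suc k) ⊕ z ⊗ T₂)))) ⊕ (h ⊗ (z ⊗ y)) ⊗ ((w ⊗ v) ⊗ W (suc k))
      ≈⟨ ⊕-cong
           (⊗-congˡ w (⊗-congˡ h (⊗-congˡ v (⊖-congˡ (T 0) (⊗-congˡ (z ⊗ y) (≈-sym T₁≈))))))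
           (≈-trans (⊗-congˡ (h ⊗ (z ⊗ y)) (w^k-W (suc k) k<r)) (⊗-identityʳ (h ⊗ (z ⊗ y)))) ⟩
    w ⊗ (h ⊗ (v ⊗ (T 0 ⊖ (z ⊗ y) ⊗ T (suc k)))) ⊕ h ⊗ (z ⊗ y)
      -- With `h` written as `w ⊖ z`, the two products of `w`, `z` and `y` cancel in the next step.
      ≈⟨ ⊕-cong (⊗-congˡ w (partial-sum k (ℕ.<⇒≤ k<r))) (⊗-congʳ (z ⊗ y) h≈w⊖z) ⟩
    w ⊗ (z ⊗ (v ⊖ y)) ⊕ (w ⊖ z) ⊗ (z ⊗ y)
      ≈⟨ solve 4 (λ w z v y → w :* (z :* (v :- y)) :+ (w :- z) :* (z :* y) := z :* (w :* v :- z :* y)) ≈-refl w z v y ⟩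
    z ⊗ (w ⊗ v ⊖ z ⊗ y) ∎
    where
    open SetoidReasoning setoid
    v y T₂ : Series
    v = w ^^ k
    y = z ^^ k
    T₂ = T (suc (suc k))
    T₁≈ : T (suc k) ≈ W (suc k) ⊕ z ⊗ T₂
    T₁≈ = ≈-trans (T-unroll (suc k)) (⊕-congʳ (z ⊗ T₂) (L-∤ (>⇒∤ k<r)))

  -- At `k = m` the remainder in `partial-sum` is `T r` times `w ^^ m ⊗ z ^^ r`; `T-period 0` turns
  -- it into `z ^^ r ⊗ T 0`, which closes the equation in `T 0`.
  functional-equation : h ⊗ ((w ^^ m ⊖ z ^^ r) ⊗ T 0) ≈ z ⊗ (w ^^ m ⊖ z ^^ m)
  functional-equation = begin
    h ⊗ ((w ^^ m ⊖ z ^^ r) ⊗ T 0)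
      ≈⟨ ⊗-congˡ h (solve 3 (λ v y F → (v :- y) :* F := v :* F :- y :* F) ≈-refl (w ^^ m) (z ^^ r) (T 0)) ⟩
    h ⊗ (w ^^ m ⊗ T 0 ⊖ z ^^ r ⊗ T 0)
      ≈⟨ ⊗-congˡ h (⊖-congˡ (w ^^ m ⊗ T 0) (⊗-congˡ (z ^^ r) (T-period 0))) ⟨
    h ⊗ (w ^^ m ⊗ T 0 ⊖ z ^^ r ⊗ (w ^^ m ⊗ T r))
      ≈⟨ ⊗-congˡ h (solve 4 (λ v y F X → v :* F :- y :* (v :* X) := v :* (F :- y :* X)) ≈-refl
           (w ^^ m) (z ^^ r) (T 0) (T r)) ⟩
    h ⊗ (w ^^ m ⊗ (T 0 ⊖ z ^^ r ⊗ T r))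
      ≈⟨ partial-sum m ℕ.≤-refl ⟩
    z ⊗ (w ^^ m ⊖ z ^^ m) ∎
    where open SetoidReasoning setoid

  Σg≈T₀ : Σ≥1 (g r) ≈ T 0
  -- The constant term of `T 0` counts `leading 0 0`, which is empty because `r` divides 0.
  Σg≈T₀ zero    = sym (L-∣ (r ∣0) 0)
  Σg≈T₀ (suc n) = cong +_ (sym (length-startingAt (suc n)))

-- Passage to quotients and the closed form

÷-⊗-÷ : ∀ A B C D (B₀ : B 0 ≡ 1ℤ) (D₀ : D 0 ≡ 1ℤ) {F} →
  -- Both denominators have constant term 1, hence so does `B ⊗ D`, and it can be cancelled.
  B ⊗ (D ⊗ F) ≈ A ⊗ C → F ≈ (A ÷ B [ B₀ ]) ⊗ (C ÷ D [ D₀ ])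
÷-⊗-÷ A B C D B₀ D₀ {F} eq = ⊗-cancelˡ (B ⊗ D) (cong₂ ℤ._*_ B₀ D₀) (begin
  (B ⊗ D) ⊗ F                ≈⟨ ⊗-assoc B D F ⟩
  B ⊗ (D ⊗ F)                ≈⟨ eq ⟩
  A ⊗ C                      ≈⟨ ⊗-cong (÷-correct A B B₀) (÷-correct C D D₀) ⟨
  (P ⊗ B) ⊗ (Q ⊗ D)          ≈⟨ solve 4 (λ P B Q D → (P :* B) :* (Q :* D) := (B :* D) :* (P :* Q)) ≈-refl P B Q D ⟩
  (B ⊗ D) ⊗ (P ⊗ Q)          ∎)
  where
  open SetoidReasoning setoid
  P Q : Series
  P = A ÷ B [ B₀ ]
  Q = C ÷ D [ D₀ ]

mainTheorem13 : (r : ℕ) (2≤r : 2 ≤ r) →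
    Σ≥1 (g r)
    ≈ (z ÷ (𝟙 ⊖ (+ 2) • z) [ refl ])
    ⊗ (((𝟙 ⊖ z) ^^ (r ∸ 1) ⊖ z ^^ (r ∸ 1)) ÷ ((𝟙 ⊖ z) ^^ (r ∸ 1) ⊖ z ^^ r) [ denominator₀ r 2≤r ])
mainTheorem13 (suc m) 2≤r =
  ≈-trans Σg≈T₀ (÷-⊗-÷ z h (w ^^ m ⊖ z ^^ m) (w ^^ m ⊖ z ^^ suc m) refl (denominator₀ (suc m) 2≤r) functional-equation)
  where open GeneratingFunctions m
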